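{- For all $n\ge 0$, the quadruple of statistics $(\operatorname{asc},\operatorname{des},\operatorname{MNA},\operatorname{MND})$ has the same distribution on $S_n(231,312)$ as on $S_n(213,231)$, i.e. $$\sum_{\pi\in S_n(231,312)} t_1^{\operatorname{asc}(\pi)}t_2^{\operatorname{des}(\pi)}t_3^{\operatorname{MNA}(\pi)}t_4^{\operatorname{MND}(\pi)}=\sum_{\sigma\in S_n(213,231)} t_1^{\operatorname{asc}(\sigma)}t_2^{\operatorname{des}(\sigma)}t_3^{\operatorname{MNA}(\sigma)}t_4^{\operatorname{MND}(\sigma)}.$$
   Context: For $n\ge 0$, $S_n$ denotes the set of permutations $\pi=\pi_1\cdots\pi_n$ of $[n]=\{1,\dots,n\}$. $\pi$ avoids a pattern $\tau\in S_k$ if no subsequence $\pi_{i_1}\cdots\pi_{i_k}$ ($i_1<\dots<i_k$) satisfies $\pi_{i_a}<\pi_{i_b}\iff\tau_a<\tau_b$; $S_n(\tau,\rho)$ is the set of permutations in $S_n$ avoiding both $\tau$ and $\rho$. $\operatorname{asc}(\pi)$ (resp. $\operatorname{des}(\pi)$) is the number of $i\in[n-1]$ with $\pi_i<\pi_{i+1}$ (resp. $\pi_i>\pi_{i+1}$). $\operatorname{MNA}(\pi)$ is the maximum size of a set $I\subseteq[n-1]$ such that $\pi_i<\pi_{i+1}$ for all $i\in I$ and $|i-j|\ge 2$ for distinct $i,j\in I$; $\operatorname{MND}(\pi)$ is defined analogously with $\pi_i>\pi_{i+1}$. -}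

module Defs where

open import Algebra.Bundles using (CommutativeSemiring)
import Algebra.Definitions.RawSemiring as RawSemiringDefs
open import Data.Fin.Base as Fin using (Fin; toℕ)
import Data.Fin.Properties as Fin
open import Data.Fin.Subset using (Subset; inside; outside; _⊆_; ∣_∣) renaming (_∈_ to _∈ₛ_)
open import Data.Fin.Subset.Properties using (_⊆?_; _∈?_)
open import Data.List.Base using (List; []; _∷_; map; filter; foldr; length; upTo; cartesianProductWith)
open import Data.List.Extrema.Nat using (max)
open import Data.Nat.Base using (ℕ; zero; suc; pred; _≤_; _<_; ∣_-_∣)
open import Data.Nat.Properties using (_≟_; _<?_; _>?_; _≤?_)
open import Data.Product.Base using (∃; _×_; _,_; uncurry)
open import Data.Vec.Base using (Vec; []; _∷_; lookup)
open import Data.Vec.Relation.Unary.AllPairs using (allPairs?)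
open import Data.Vec.Relation.Unary.Unique.Propositional using (Unique)
open import Function.Bundles using (_⇔_; mk⇔; Equivalence)
open import Level using (0ℓ)
open import Relation.Binary.Core using (Rel)
open import Relation.Binary.Definitions using (Decidable)
open import Relation.Binary.PropositionalEquality.Core using (_≢_)
open import Relation.Nullary.Decidable using (Dec; does; map′; ¬?; _×-dec_; _→-dec_)
open import Relation.Nullary.Negation using (¬_)
import Relation.Unary as Unary

words : ∀ {A : Set} → List A → (k : ℕ) → List (Vec A k)
words xs zero    = [] ∷ []
words xs (suc k) = cartesianProductWith _∷_ xs (words xs k)

unique? : ∀ {n} (π : Vec ℕ n) → Dec (Unique π)
unique? = allPairs? (λ x y → ¬? (x ≟ y))

-- Permutations are in one-line notation, with values in {1 , … , n}.
permutations : (n : ℕ) → List (Vec ℕ n)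
permutations n = filter unique? (words (map suc (upTo n)) n)

module _ {n k : ℕ} (π : Vec ℕ n) (τ : Vec ℕ k) where

  Increasing : Vec (Fin n) k → Set
  Increasing i = ∀ a b → a Fin.< b → lookup i a Fin.< lookup i b

  OrderIsomorphic : Vec (Fin n) k → Set
  OrderIsomorphic i = ∀ a b →
    lookup π (lookup i a) < lookup π (lookup i b) ⇔ lookup τ a < lookup τ b

  Contains : Set
  Contains = ∃ λ (i : Vec (Fin n) k) → Increasing i × OrderIsomorphic i

  Avoids : Set
  Avoids = ¬ Contains

∃Vec? : ∀ {n} k {P : Vec (Fin n) k → Set} → Unary.Decidable P → Dec (∃ P)
∃Vec? zero    P? = map′ ([] ,_) (λ { ([] , p) → p }) (P? [])
∃Vec? (suc k) P? = map′ (λ { (x , v , p) → x ∷ v , p }) (λ { (x ∷ v , p) → x , v , p })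
                        (Fin.any? λ x → ∃Vec? k λ v → P? (x ∷ v))

_⇔-dec_ : ∀ {A B : Set} → Dec A → Dec B → Dec (A ⇔ B)
a? ⇔-dec b? = map′ (uncurry mk⇔) (λ e → Equivalence.to e , Equivalence.from e)
                   ((a? →-dec b?) ×-dec (b? →-dec a?))

avoids? : ∀ {n k} (π : Vec ℕ n) (τ : Vec ℕ k) → Dec (Avoids π τ)
avoids? {k = k} π τ = ¬? (∃Vec? k λ i →
  (Fin.all? λ a → Fin.all? λ b → (a Fin.<? b) →-dec (lookup i a Fin.<? lookup i b))
  ×-dec
  (Fin.all? λ a → Fin.all? λ b →
    (lookup π (lookup i a) <? lookup π (lookup i b)) ⇔-dec (lookup τ a <? lookup τ b)))

-- The set Sₙ(τ, ρ), listed without repetition.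
avoiders : ∀ (n : ℕ) {k l} → Vec ℕ k → Vec ℕ l → List (Vec ℕ n)
avoiders n τ ρ = filter (λ π → avoids? π τ ×-dec avoids? π ρ) (permutations n)

-- Positions i ∈ [n-1], indexed by Fin (pred n), whose consecutive entries
-- πᵢ and πᵢ₊₁ are related by R.
positions : ∀ {R : Rel ℕ 0ℓ} → Decidable R → ∀ {n} → Vec ℕ n → Subset (pred n)
positions R? []          = []
positions R? (x ∷ [])    = []
positions R? (x ∷ y ∷ w) = does (R? x y) ∷ positions R? (y ∷ w)

NonAdjacent : ∀ {m} → Subset m → Set
NonAdjacent I = ∀ i j → i ∈ₛ I → j ∈ₛ I → i ≢ j → 2 ≤ ∣ toℕ i - toℕ j ∣

nonAdjacent? : ∀ {m} (I : Subset m) → Dec (NonAdjacent I)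
nonAdjacent? I = Fin.all? λ i → Fin.all? λ j →
  (i ∈? I) →-dec (j ∈? I) →-dec ¬? (i Fin.≟ j) →-dec (2 ≤? ∣ toℕ i - toℕ j ∣)

-- The default value 0 of max is the size of the empty set, which always qualifies.
maxNonAdjacent : ∀ {m} → Subset m → ℕ
maxNonAdjacent {m} J =
  max 0 (map ∣_∣ (filter (λ I → (I ⊆? J) ×-dec nonAdjacent? I)
                         (words (outside ∷ inside ∷ []) m)))

asc des MNA MND : ∀ {n} → Vec ℕ n → ℕ
asc π = ∣ positions _<?_ π ∣
des π = ∣ positions _>?_ π ∣
MNA π = maxNonAdjacent (positions _<?_ π)
MND π = maxNonAdjacent (positions _>?_ π)

frequency : ∀ {n} → List (Vec ℕ n) → (a b c d : ℕ) → ℕ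
frequency L a b c d =
  length (filter (λ π → (asc π ≟ a) ×-dec (des π ≟ b) ×-dec (MNA π ≟ c) ×-dec (MND π ≟ d)) L)

-- The value of the generating polynomial of (asc, des, MNA, MND) at a point of a
-- commutative semiring.  An identity in ℕ[t₁,t₂,t₃,t₄] amounts to equality of such
-- values at all points of all commutative semirings.
module _ {c ℓ} (R : CommutativeSemiring c ℓ) where
  open CommutativeSemiring R
  open RawSemiringDefs rawSemiring using (_^_)

  generatingFunction : (t₁ t₂ t₃ t₄ : Carrier) → ∀ {n} → List (Vec ℕ n) → Carrier
  generatingFunction t₁ t₂ t₃ t₄ L =
    foldr _+_ 0# (map (λ π → t₁ ^ asc π * t₂ ^ des π * t₃ ^ MNA π * t₄ ^ MND π) L)

{-# OPTIONS --safe #-}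
-- In each of the two classes a permutation is determined by its ascent set, and every
-- subset of [n-1] is an ascent set: an element of Sₙ(231,312) is a direct sum of
-- decreasing blocks, and in an element of Sₙ(213,231) each entry is the minimum or the
-- maximum of the entries from it onwards.  All four statistics depend on the ascent set
-- only, so both classes have the distribution of the statistics on subsets of [n-1].
-- In both classes the ascent set determines the Lehmer code (hence injectivity), and a
-- new first entry can be prepended so as to create an ascent or a descent at will
-- (hence surjectivity).
module Submission where

open import Defs
open import Algebra.Bundles using (CommutativeSemiring)
open import Data.Bool.Base using (Bool; true; false; not)
open import Data.Empty using (⊥; ⊥-elim)
open import Data.Fin.Base as Fin using (Fin; zero; suc)
open import Data.Fin.Patterns using (0F; 1F; 2F)
open import Data.Fin.Subset using (Subset; inside; outside; ∁; ∣_∣)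
open import Data.List.Base as List using (List; []; _∷_; _++_; filter; length; upTo)
open import Data.List.Membership.Propositional using (_∈_)
open import Data.List.Membership.Propositional.Properties
open import Data.List.Membership.Propositional.Properties.WithK using (unique∧set⇒bag)
import Data.List.Properties as List
open import Data.List.Relation.Binary.BagAndSetEquality using (∼bag⇒↭)
open import Data.List.Relation.Binary.Permutation.Propositional
  using (_↭_; prep; ↭-refl; ↭-reflexive; ↭-sym; ↭-trans; ↭⇒↭ₛ′)
open import Data.List.Relation.Binary.Permutation.Propositional.Properties
  using (∈-resp-↭; ↭-length; shift; drop-∷; filter-↭; map⁺)
import Data.List.Relation.Binary.Permutation.Setoid.Properties as ↭ₛ
import Data.List.Relation.Binary.Sublist.Propositional as Sublist
import Data.List.Relation.Binary.Sublist.Propositional.Properties as Sublist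
open import Data.List.Relation.Unary.All as ListAll using ([]; _∷_)
open import Data.List.Relation.Unary.Any using (here; there)
open import Data.List.Relation.Unary.AllPairs using ([]; _∷_)
import Data.List.Relation.Unary.Unique.Propositional as ListUnique
import Data.List.Relation.Unary.Unique.Propositional.Properties as ListUnique
open import Data.Nat.Base using (ℕ; zero; suc; pred; _≤_; _<_; z≤n; s≤s)
open import Data.Nat.Properties
open import Data.Product.Base using (∃; _×_; _,_; proj₁; proj₂)
open import Data.Sum.Base using (_⊎_; inj₁; inj₂)
open import Data.Vec.Base as Vec using (Vec; []; _∷_; lookup; map; toList)
open import Data.Vec.Properties using (∷-injective; lookup-map; length-toList)
open import Data.Vec.Relation.Unary.All as All using (All; []; _∷_)
import Data.Vec.Relation.Unary.All.Properties as All
open import Data.Vec.Relation.Unary.AllPairs using ([]; _∷_)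
open import Data.Vec.Relation.Unary.Unique.Propositional using (Unique)
import Data.Vec.Relation.Unary.Unique.Propositional.Properties as Unique
open import Function.Base using (_∘_)
open import Function.Bundles using (_⇔_; mk⇔; Equivalence)
open import Relation.Binary.Definitions using (tri<; tri≈; tri>)
open import Relation.Binary.PropositionalEquality
  using (_≡_; _≢_; refl; sym; trans; cong; cong₂; subst; ≢-sym; module ≡-Reasoning)
open import Relation.Nullary.Decidable
  using (Dec; yes; no; does; dec-true; dec-false; from-yes; _×-dec_)
open import Relation.Nullary.Negation using (¬_; contradiction)
open import Relation.Unary using (Decidable)

private variable
  n : ℕ
  b : Bool
  x x′ y v : ℕ
  w w′ π σ : Vec ℕ n

-- Repetition-free lists, words and subsets

-- Cut `ys` at an occurrence of `x`. The remaining entries of `xs` differ from `x`, so they still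
-- occur in what is left, and the induction goes on; `zs` collects the surplus.
unique-⊆⇒↭-++ : ∀ {A : Set} {xs ys : List A} → ListUnique.Unique xs →
  (∀ {v} → v ∈ xs → v ∈ ys) → ∃ λ zs → xs ++ zs ↭ ys
unique-⊆⇒↭-++ {xs = []} {ys} [] sub = ys , ↭-refl
unique-⊆⇒↭-++ {xs = x ∷ xs} (x∉xs ∷ xs!) sub
  with as , bs , refl ← ∈-∃++ (sub (here refl))
  = let zs , p = unique-⊆⇒↭-++ xs! sub′ in zs , ↭-trans (prep x p) (↭-sym (shift x as bs))
  where
  sub′ : ∀ {v} → v ∈ xs → v ∈ as ++ bs
  sub′ v∈xs with ∈-resp-↭ (shift x as bs) (sub (there v∈xs))
  ... | here refl = contradiction refl (ListAll.lookup x∉xs v∈xs)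
  ... | there v∈  = v∈

-- Pigeonhole principle: equal lengths leave no room for a surplus.
unique-⊆-length⇒↭ : ∀ {A : Set} {xs ys : List A} → ListUnique.Unique xs →
  (∀ {v} → v ∈ xs → v ∈ ys) → length xs ≡ length ys → xs ↭ ys
unique-⊆-length⇒↭ {xs = xs} xs! sub eq with unique-⊆⇒↭-++ xs! sub
... | []     , p = subst (_↭ _) (List.++-identityʳ xs) p
... | z ∷ zs , p = contradiction
  (trans (trans (sym (List.length-++ xs)) (↭-length p)) (sym eq)) (m+1+n≢m (length xs))

length-filter-map : ∀ {A B : Set} {P : B → Set} (P? : Decidable P) (f : A → B) xs →
  length (filter P? (List.map f xs)) ≡ length (filter (P? ∘ f) xs)
length-filter-map P? f []       = refl
length-filter-map P? f (x ∷ xs) with does (P? (f x))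
... | true  = cong suc (length-filter-map P? f xs)
... | false = length-filter-map P? f xs

toList-unique : ∀ {A : Set} {v : Vec A n} → Unique v → ListUnique.Unique (toList v)
toList-unique []         = []
toList-unique (x∉v ∷ v!) = All.toList⁺ x∉v ∷ toList-unique v!

∈-words⁺ : ∀ {A : Set} {xs : List A} {k} {v : Vec A k} → All (_∈ xs) v → v ∈ words xs k
∈-words⁺ []       = here refl
∈-words⁺ (p ∷ ps) = ∈-cartesianProductWith⁺ _∷_ p (∈-words⁺ ps)

∈-words⁻ : ∀ {A : Set} {xs : List A} {k} {v : Vec A k} → v ∈ words xs k → All (_∈ xs) v
∈-words⁻ {k = zero} {[]} _ = []
∈-words⁻ {xs = xs} {suc k} v∈
  with _ , _ , p , q , refl ← ∈-cartesianProductWith⁻ _∷_ xs (words xs k) v∈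
  = p ∷ ∈-words⁻ q

words-unique : ∀ {A : Set} {xs : List A} → ListUnique.Unique xs →
  ∀ k → ListUnique.Unique (words xs k)
words-unique xs! zero    = [] ∷ []
words-unique xs! (suc k) =
  ListUnique.cartesianProductWith⁺ _∷_ ∷-injective xs! (words-unique xs! k)

subsets : ∀ m → List (Subset m)
subsets = words (outside ∷ inside ∷ [])

∈-subsets : ∀ {m} (s : Subset m) → s ∈ subsets m
∈-subsets s = ∈-words⁺ (All.universal (λ where
  false → here refl
  true  → there (here refl)) s)

subsets-unique : ∀ m → ListUnique.Unique (subsets m)
subsets-unique = words-unique
  (((λ ()) ∷ []) ∷ ([] ∷ []))

-- Permutations

InRange : ℕ → ℕ → Set
InRange n v = 1 ≤ v × v ≤ n

∈-range⁺ : InRange n v → v ∈ List.map suc (upTo n)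
∈-range⁺ {v = suc v} (_ , v<n) = ∈-map⁺ suc (∈-upTo⁺ v<n)

∈-range⁻ : v ∈ List.map suc (upTo n) → InRange n v
∈-range⁻ v∈ with _ , u∈ , refl ← ∈-map⁻ suc v∈ = s≤s z≤n , ∈-upTo⁻ u∈

IsPermutation : Vec ℕ n → Set
IsPermutation {n} π = Unique π × All (InRange n) π

∈-permutations⁺ : IsPermutation π → π ∈ permutations n
∈-permutations⁺ (π! , r) = ∈-filter⁺ unique? (∈-words⁺ (All.map ∈-range⁺ r)) π!

∈-permutations⁻ : π ∈ permutations n → IsPermutation π
∈-permutations⁻ {n = n} π∈
  with p , π! ← ∈-filter⁻ unique? {xs = words (List.map suc (upTo n)) n} π∈
  = π! , All.map ∈-range⁻ (∈-words⁻ p)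

permutations-unique : ∀ n → ListUnique.Unique (permutations n)
permutations-unique n = ListUnique.filter⁺ unique?
  (words-unique (ListUnique.map⁺ suc-injective (ListUnique.upTo⁺ n)) n)

-- Hence any two permutations of the same length are rearrangements of each other, as
-- `lehmer-injective` requires.
permutation-↭ : {π : Vec ℕ n} → IsPermutation π → toList π ↭ List.map suc (upTo n)
permutation-↭ {n} {π} (π! , r) = unique-⊆-length⇒↭ (toList-unique π!)
  (ListAll.lookup (All.toList⁺ (All.map ∈-range⁺ r)))
  (trans (length-toList π) (sym (trans (List.length-map suc (upTo n)) (List.length-upTo n))))

-- Lehmer codes

rank : ℕ → Vec ℕ n → ℕ
rank x w = length (filter (_<? x) (toList w))

lehmer : Vec ℕ n → Vec ℕ n
lehmer []      = []
lehmer (x ∷ w) = rank x w ∷ lehmer w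

rank-min : All (x <_) w → rank x w ≡ 0
rank-min p = cong length (List.filter-none (_<? _) (All.toList⁺ (All.map <-asym p)))

rank-max : {w : Vec ℕ n} → All (_< x) w → rank x w ≡ n
rank-max {w = w} p =
  trans (cong length (List.filter-all (_<? _) (All.toList⁺ p))) (length-toList w)

rank-head : x ≤ y → rank x (y ∷ w) ≡ rank x w
rank-head x≤y = cong length (List.filter-reject (_<? _) (≤⇒≯ x≤y))

rank-∷ : y < x → rank x (y ∷ w) ≡ suc (rank x w)
rank-∷ y<x = cong length (List.filter-accept (_<? _) y<x)

rank-cong : All (λ v → v < x ⇔ v < y) w → rank x w ≡ rank y w
rank-cong []                         = refl
rank-cong {x} {y} (_∷_ {x = v} {xs = w} p ps) with v <? x
... | yes v<x = trans (rank-∷ {w = w} v<x)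
  (trans (cong suc (rank-cong ps)) (sym (rank-∷ {w = w} (Equivalence.to p v<x))))
... | no v≮x  = trans (rank-head {w = w} (≮⇒≥ v≮x))
  (trans (rank-cong ps) (sym (rank-head {w = w} (≮⇒≥ (v≮x ∘ Equivalence.from p)))))

rank-mono : (w : Vec ℕ n) → x ≤ y → rank x w ≤ rank y w
rank-mono {x = x} {y} w x≤y = Sublist.length-mono-≤ (Sublist.filter⁺ (_<? x) (_<? y)
  (λ { refl v<x → <-≤-trans v<x x≤y }) (Sublist.⊆-refl {x = toList w}))

rank-↭ : ∀ x → toList π ↭ toList σ → rank x π ≡ rank x σ
rank-↭ x p = ↭-length (filter-↭ (_<? x) p)

-- Strictness comes from `x` itself: it is counted below `y` in the common multiset of entries but
-- not in `rank x w`, whereas `y` does not count itself.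
rank-head-< : toList (x ∷ w) ↭ toList (y ∷ w′) → x < y → rank x w < rank y w′
rank-head-< {x = x} {w = w} {y = y} {w′ = w′} p x<y = begin-strict
  rank x w         ≤⟨ rank-mono w (<⇒≤ x<y) ⟩
  rank y w         <⟨ ≤-reflexive (sym (rank-∷ {w = w} x<y)) ⟩
  rank y (x ∷ w)   ≡⟨ rank-↭ {π = x ∷ w} {σ = y ∷ w′} y p ⟩
  rank y (y ∷ w′)  ≡⟨ rank-head {w = w′} ≤-refl ⟩
  rank y w′        ∎
  where open ≤-Reasoning

-- The smaller of two different heads would have the smaller first digit. So the heads agree, and
-- cancelling them leaves tails with a common multiset.
lehmer-injective : {π σ : Vec ℕ n} → toList π ↭ toList σ → lehmer π ≡ lehmer σ → π ≡ σ
lehmer-injective {π = []}    {[]}     p eq = refl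
lehmer-injective {π = x ∷ w} {y ∷ w′} p eq with eq₁ , eq₂ ← ∷-injective eq | <-cmp x y
... | tri< x<y _ _  = contradiction eq₁ (<⇒≢ (rank-head-< {w = w} {w′ = w′} p x<y))
... | tri≈ _ refl _ = cong (x ∷_) (lehmer-injective (drop-∷ p) eq₂)
... | tri> _ _ y<x  =
  contradiction (sym eq₁) (<⇒≢ (rank-head-< {w = w′} {w′ = w} (↭-sym p) y<x))

-- Prepending an entry

StrictlyMonotone : (ℕ → ℕ) → Set
StrictlyMonotone f = ∀ {u v} → u < v → f u < f v

module _ {f : ℕ → ℕ} (mono : StrictlyMonotone f) where

  cancel-< : ∀ {u v} → f u < f v → u < v
  cancel-< {u} {v} fu<fv with <-cmp u v
  ... | tri< u<v _ _  = u<v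
  ... | tri≈ _ refl _ = contradiction fu<fv (<-irrefl refl)
  ... | tri> _ _ v<u  = contradiction (mono v<u) (<-asym fu<fv)

  strictlyMonotone⇒injective : ∀ {u v} → f u ≡ f v → u ≡ v
  strictlyMonotone⇒injective {u} {v} eq with <-cmp u v
  ... | tri< u<v _ _ = contradiction eq (<⇒≢ (mono u<v))
  ... | tri≈ _ u≡v _ = u≡v
  ... | tri> _ _ v<u = contradiction (sym eq) (<⇒≢ (mono v<u))

-- bump x renumbers the values by skipping x.
bump : ℕ → ℕ → ℕ
bump x v with v <? x
... | yes _ = v
... | no  _ = suc v

bump-< : v < x → bump x v ≡ v
bump-< {v} {x} v<x with v <? x
... | yes _   = refl
... | no  v≮x = contradiction v<x v≮x

bump-≥ : x ≤ v → bump x v ≡ suc v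
bump-≥ {x} {v} x≤v with v <? x
... | yes v<x = contradiction v<x (≤⇒≯ x≤v)
... | no  _   = refl

bump-strictlyMonotone : ∀ x → StrictlyMonotone (bump x)
bump-strictlyMonotone x {u} {v} u<v with u <? x | v <? x
... | yes _  | yes _   = u<v
... | yes _  | no _    = m<n⇒m<1+n u<v
... | no _   | no _    = s≤s u<v
... | no u≮x | yes v<x = contradiction (<-trans u<v v<x) u≮x

bump-≢ : ∀ x v → x ≢ bump x v
bump-≢ x v eq with v <? x
... | yes v<x = <⇒≢ v<x (sym eq)
... | no  v≮x = v≮x (≤-reflexive (sym eq))

bump-inRange : ∀ x → InRange n v → InRange (suc n) (bump x v)
bump-inRange {v = v} x (1≤v , v≤n) with v <? x
... | yes _ = 1≤v , m≤n⇒m≤1+n v≤n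
... | no  _ = s≤s z≤n , s≤s v≤n

prepend : ℕ → Vec ℕ n → Vec ℕ (suc n)
prepend x π = x ∷ map (bump x) π

prepend-isPermutation : InRange (suc n) x → {π : Vec ℕ n} →
  IsPermutation π → IsPermutation (prepend x π)
prepend-isPermutation {x = x} x∈ {π} (π! , r) =
  (All.map⁺ (All.universal (bump-≢ x) π) ∷
    Unique.map⁺ (strictlyMonotone⇒injective (bump-strictlyMonotone x)) π!) ,
  x∈ ∷ All.gmap (bump-inRange x) r

-- Pattern containment

-- Recording a strict inequality on both sides lets one datum settle the comparison in both
-- directions, as `OrderIsomorphic` demands.
SameOrder : ℕ → ℕ → ℕ → ℕ → Set
SameOrder u v s t = (u < v × s < t) ⊎ (v < u × t < s)

sameOrder⇒⇔ : ∀ {u v s t} → SameOrder u v s t → u < v ⇔ s < t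
sameOrder⇒⇔ (inj₁ (u<v , s<t)) = mk⇔ (λ _ → s<t) (λ _ → u<v)
sameOrder⇒⇔ (inj₂ (v<u , t<s)) =
  mk⇔ (⊥-elim ∘ <-asym v<u) (⊥-elim ∘ <-asym t<s)

sameOrder-flip : ∀ {u v s t} → SameOrder u v s t → SameOrder v u t s
sameOrder-flip (inj₁ p) = inj₂ p
sameOrder-flip (inj₂ p) = inj₁ p

irrefl-⇔ : ∀ {u s} → u < u ⇔ s < s
irrefl-⇔ = mk⇔ (⊥-elim ∘ <-irrefl refl) (⊥-elim ∘ <-irrefl refl)

-- Each step is decided by the head, its neighbour and one later entry, so occurrences of this form
-- are the only ones that have to be built. The three pairwise comparisons determine all nine.
contains-first-two : ∀ {r s t} (k : Fin n) → SameOrder x y r s →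
  SameOrder x (lookup w k) r t → SameOrder y (lookup w k) s t →
  Contains (x ∷ y ∷ w) (r ∷ s ∷ t ∷ [])
contains-first-two {n} {x} {y} {w} {r} {s} {t} k o₀₁ o₀₂ o₁₂ = i , increasing , iso
  where
  i : Vec (Fin (suc (suc n))) 3
  i = 0F ∷ 1F ∷ suc (suc k) ∷ []

  iso : OrderIsomorphic (x ∷ y ∷ w) (r ∷ s ∷ t ∷ []) i
  iso 0F 0F = irrefl-⇔
  iso 0F 1F = sameOrder⇒⇔ o₀₁
  iso 0F 2F = sameOrder⇒⇔ o₀₂
  iso 1F 0F = sameOrder⇒⇔ (sameOrder-flip o₀₁)
  iso 1F 1F = irrefl-⇔
  iso 1F 2F = sameOrder⇒⇔ o₁₂
  iso 2F 0F = sameOrder⇒⇔ (sameOrder-flip o₀₂)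
  iso 2F 1F = sameOrder⇒⇔ (sameOrder-flip o₁₂)
  iso 2F 2F = irrefl-⇔

  increasing : ∀ a b → a Fin.< b → lookup i a Fin.< lookup i b
  increasing 0F 0F ()
  increasing 0F 1F _ = s≤s z≤n
  increasing 0F 2F _ = s≤s z≤n
  increasing 1F 0F ()
  increasing 1F 1F (s≤s ())
  increasing 1F 2F _ = s≤s (s≤s z≤n)
  increasing 2F 0F ()
  increasing 2F 1F (s≤s ())
  increasing 2F 2F (s≤s (s≤s ()))

avoids-tail : ∀ {k} (τ : Vec ℕ k) → Avoids (x ∷ w) τ → Avoids w τ
avoids-tail {x = x} {w = w} τ av (i , inc , iso) = av (map suc i , inc′ , iso′)
  where
  inc′ : ∀ a b → a Fin.< b → lookup (map suc i) a Fin.< lookup (map suc i) b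
  inc′ a b a<b rewrite lookup-map a Fin.suc i | lookup-map b Fin.suc i = s≤s (inc a b a<b)

  iso′ : OrderIsomorphic (x ∷ w) τ (map suc i)
  iso′ a b rewrite lookup-map a Fin.suc i | lookup-map b Fin.suc i = iso a b

-- Serves to treat ascent and descent separately in a type indexed by the Boolean `does (x <? y)`.
does-elim : ∀ {P : Set} (F : Bool → Set) (P? : Dec P) → (P → F true) → (¬ P → F false) →
  F (does P?)
does-elim F (yes p) f g = f p
does-elim F (no ¬p) f g = g ¬p

-- Families determined by ascents

-- Step b x w relates x to the entries w after it; b says whether x starts an ascent, so
-- that the index s of Shaped is the ascent set.
module _ (Step : Bool → ℕ → ∀ {n} → Vec ℕ n → Set) where

  data Shaped : ∀ {n} → Subset (pred n) → Vec ℕ n → Set where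
    []  : Shaped [] []
    [-] : Shaped [] (x ∷ [])
    _∷_ : ∀ {s : Subset n} → Step b x (y ∷ w) → Shaped s (y ∷ w) → Shaped (b ∷ s) (x ∷ y ∷ w)

-- `step-rank` makes each Lehmer digit a function of the bit and of the code of the tail. `newHead`
-- realises either bit in front of any nonempty permutation, and `step-map` keeps the shape of the
-- rest under the renumbering by `bump`.
record Family (τ ρ : Vec ℕ 3) : Set₁ where
  field
    Step          : Bool → ℕ → ∀ {n} → Vec ℕ n → Set
    step-ascent   : Step b x (y ∷ w) → does (x <? y) ≡ b
    step-map      : ∀ {f} → StrictlyMonotone f → Step b x w → Step b (f x) (map f w)
    step-rank     : {w w′ : Vec ℕ (suc n)} → Step b x w → Step b x′ w′ →
                    lehmer w ≡ lehmer w′ → rank x w ≡ rank x′ w′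
    avoids⇒step   : Unique (x ∷ y ∷ w) → Avoids (x ∷ y ∷ w) τ → Avoids (x ∷ y ∷ w) ρ →
                    Step (does (x <? y)) x (y ∷ w)
    shaped⇒avoids : ∀ {n s} {π : Vec ℕ n} → Shaped Step s π → Avoids π τ × Avoids π ρ
    newHead       : Bool → Vec ℕ (suc n) → ℕ
    newHead-range : ∀ b {π : Vec ℕ (suc n)} → IsPermutation π →
                    InRange (suc (suc n)) (newHead b π)
    newHead-step  : ∀ b {π : Vec ℕ (suc n)} → IsPermutation π →
                    Step b (newHead b π) (map (bump (newHead b π)) π)

-- Membership in the class avoiding two patterns

module _ {k l} (τ : Vec ℕ k) (ρ : Vec ℕ l) where

  AvoidsBoth : Vec ℕ n → Set
  AvoidsBoth π = Avoids π τ × Avoids π ρ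

  avoidsBoth? : Decidable (AvoidsBoth {n})
  avoidsBoth? π = avoids? π τ ×-dec avoids? π ρ

  ∈-avoiders⁺ : IsPermutation π → AvoidsBoth π → π ∈ avoiders n τ ρ
  ∈-avoiders⁺ {n} {π} p av =
    ∈-filter⁺ {P = AvoidsBoth} avoidsBoth? {x = π} {xs = permutations n} (∈-permutations⁺ p) av

  ∈-avoiders⁻ : π ∈ avoiders n τ ρ → IsPermutation π × AvoidsBoth π
  ∈-avoiders⁻ {n} {π} π∈
    with ∈-filter⁻ {P = AvoidsBoth} avoidsBoth? {v = π} {xs = permutations n} π∈
  ... | p , av = ∈-permutations⁻ p , av

  avoiders-unique : ∀ n → ListUnique.Unique (avoiders n τ ρ)
  avoiders-unique n = ListUnique.filter⁺ avoidsBoth? (permutations-unique n)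

-- The bijection between a class and the subsets

module _ {τ ρ : Vec ℕ 3} (F : Family τ ρ) where
  open Family F

  shaped-positions : ∀ {n s} {π : Vec ℕ n} → Shaped Step s π → positions _<?_ π ≡ s
  shaped-positions []       = refl
  shaped-positions [-]      = refl
  shaped-positions (p ∷ ps) = cong₂ _∷_ (step-ascent p) (shaped-positions ps)

  shaped-lehmer : ∀ {n s} {π σ : Vec ℕ n} → Shaped Step s π → Shaped Step s σ →
    lehmer π ≡ lehmer σ
  shaped-lehmer []       []       = refl
  shaped-lehmer [-]      [-]      = refl
  shaped-lehmer (p ∷ ps) (q ∷ qs) = let ih = shaped-lehmer ps qs in
    cong₂ _∷_ (step-rank p q ih) ih

  shaped-map : ∀ {n s f} {π : Vec ℕ n} → StrictlyMonotone f →
    Shaped Step s π → Shaped Step s (map f π)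
  shaped-map mono []       = []
  shaped-map mono [-]      = [-]
  shaped-map mono (p ∷ ps) = step-map mono p ∷ shaped-map mono ps

  avoids⇒shaped : (π : Vec ℕ n) → Unique π → Avoids π τ → Avoids π ρ →
    Shaped Step (positions _<?_ π) π
  avoids⇒shaped []          _             _ _ = []
  avoids⇒shaped (x ∷ [])    _             _ _ = [-]
  avoids⇒shaped (x ∷ y ∷ w) π!@(_ ∷ yw!) aτ aρ =
    avoids⇒step π! aτ aρ ∷ avoids⇒shaped (y ∷ w) yw! (avoids-tail τ aτ) (avoids-tail ρ aρ)

  -- The inverse of taking ascent sets, built from the back: each bit chooses the entry to put in
  -- front.
  perm : ∀ n → Subset (pred n) → Vec ℕ n
  -- As `pred 0` and `pred 1` are both `0`, lengths 0 and 1 carry the empty ascent set only; bits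
  -- start at length 2.
  perm zero          []      = []
  perm (suc zero)    []      = 1 ∷ []
  perm (suc (suc n)) (b ∷ s) = prepend (newHead b (perm (suc n) s)) (perm (suc n) s)

  perm-isPermutation : ∀ n s → IsPermutation (perm n s)
  perm-isPermutation zero          []      = [] , []
  perm-isPermutation (suc zero)    []      = [] ∷ [] , (s≤s z≤n , s≤s z≤n) ∷ []
  perm-isPermutation (suc (suc n)) (b ∷ s) = let ih = perm-isPermutation (suc n) s in
    prepend-isPermutation (newHead-range b ih) ih

  shaped-prepend : ∀ {n s} {π : Vec ℕ (suc n)} → Step b x (map (bump x) π) →
    Shaped Step s π → Shaped Step (b ∷ s) (prepend x π)
  shaped-prepend {x = x} {π = _ ∷ _} p ps = p ∷ shaped-map (bump-strictlyMonotone x) ps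

  perm-shaped : ∀ n s → Shaped Step s (perm n s)
  perm-shaped zero          []      = []
  perm-shaped (suc zero)    []      = [-]
  perm-shaped (suc (suc n)) (b ∷ s) =
    shaped-prepend (newHead-step b (perm-isPermutation (suc n) s)) (perm-shaped (suc n) s)

  positions-perm : ∀ n s → positions _<?_ (perm n s) ≡ s
  positions-perm n s = shaped-positions (perm-shaped n s)

  -- Both sides are shaped by the same ascent set, hence have the same Lehmer code, and both have
  -- the entries `1` to `n`.
  perm-positions : IsPermutation π → Avoids π τ → Avoids π ρ →
    perm n (positions _<?_ π) ≡ π
  perm-positions {n} {π} π-perm aτ aρ = lehmer-injective
    (↭-trans (permutation-↭ (perm-isPermutation n s)) (↭-sym (permutation-↭ π-perm)))
    (shaped-lehmer (perm-shaped n s) (avoids⇒shaped π (proj₁ π-perm) aτ aρ))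
    where s = positions _<?_ π

  -- Neither list has repetitions, so comparing members suffices. On the right this uses that
  -- `perm n` is injective: the ascent set recovers the subset.
  avoiders-↭ : ∀ n → avoiders n τ ρ ↭ List.map (perm n) (subsets (pred n))
  avoiders-↭ n = ∼bag⇒↭ (unique∧set⇒bag
    (avoiders-unique τ ρ n)
    (ListUnique.map⁺ perm-injective (subsets-unique (pred n)))
    (mk⇔ to from))
    where
    perm-injective : ∀ {s t} → perm n s ≡ perm n t → s ≡ t
    perm-injective {s} {t} eq =
      trans (sym (positions-perm n s)) (trans (cong (positions _<?_) eq) (positions-perm n t))

    to : ∀ {π} → π ∈ avoiders n τ ρ → π ∈ List.map (perm n) (subsets (pred n))
    to π∈ = let p , aτ , aρ = ∈-avoiders⁻ τ ρ π∈ in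
      subst (_∈ List.map (perm n) (subsets (pred n))) (perm-positions p aτ aρ)
        (∈-map⁺ (perm n) (∈-subsets _))

    from : ∀ {π} → π ∈ List.map (perm n) (subsets (pred n)) → π ∈ avoiders n τ ρ
    from π∈ = let s , _ , eq = ∈-map⁻ (perm n) π∈ in
      subst (_∈ avoiders n τ ρ) (sym eq)
        (∈-avoiders⁺ τ ρ (perm-isPermutation n s) (shaped⇒avoids (perm-shaped n s)))

-- The two families

-- In a descent, y is the largest of the remaining values below x.
data LayeredStep : Bool → ℕ → ∀ {n} → Vec ℕ n → Set where
  rise : All (x <_) w → LayeredStep true x w
  fall : y < x → All (λ v → v < x → v < y) w → LayeredStep false x (y ∷ w)

data ExtremalStep : Bool → ℕ → ∀ {n} → Vec ℕ n → Set where
  rise : All (x <_) w → ExtremalStep true x w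
  fall : All (_< x) w → ExtremalStep false x w

bump-1-> : All (InRange n) w → All (1 <_) (map (bump 1) w)
bump-1-> = All.gmap λ (1≤v , _) → subst (1 <_) (sym (bump-≥ 1≤v)) (s≤s 1≤v)

-- Only occurrences starting at the head matter. After a fall, a later value below `x` is below `y`,
-- so `y` can replace `x` and the occurrence moves to the tail; if `y` is itself the middle entry,
-- it would have to exceed `x`.
layered-no-231 : ∀ {n s} {π : Vec ℕ n} → Shaped LayeredStep s π →
  ∀ p q r → p Fin.< q → q Fin.< r →
  lookup π r < lookup π p → lookup π p < lookup π q → ⊥
layered-no-231 (_ ∷ ps) (suc p) (suc q) (suc r) (s≤s p<q) (s≤s q<r) =
  layered-no-231 ps p q r p<q q<r
layered-no-231 (rise h ∷ _) zero q (suc r) _ _ r<p _ = <-asym r<p (All.lookup⁺ h r)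
layered-no-231 (fall y<x _ ∷ _) zero 1F r _ _ _ p<q = <-asym p<q y<x
layered-no-231 (fall y<x h ∷ ps) zero (suc (suc q)) (suc (suc r)) _ (s≤s q<r) r<p p<q =
  layered-no-231 ps zero (suc q) (suc r) (s≤s z≤n) q<r (All.lookup⁺ h r r<p) (<-trans y<x p<q)
layered-no-231 (fall _ _ ∷ _) zero (suc (suc q)) 1F _ (s≤s ())

-- The same replacement of `x` by `y`: the last entry of the occurrence is below `x`, hence below
-- `y`, which is absurd when `y` is the middle entry.
layered-no-312 : ∀ {n s} {π : Vec ℕ n} → Shaped LayeredStep s π →
  ∀ p q r → p Fin.< q → q Fin.< r →
  lookup π q < lookup π r → lookup π r < lookup π p → ⊥
layered-no-312 (_ ∷ ps) (suc p) (suc q) (suc r) (s≤s p<q) (s≤s q<r) =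
  layered-no-312 ps p q r p<q q<r
layered-no-312 (rise h ∷ _) zero q (suc r) _ _ _ r<p = <-asym r<p (All.lookup⁺ h r)
layered-no-312 (fall _ _ ∷ _) zero (suc q) 1F _ (s≤s ())
layered-no-312 (fall _ h ∷ _) zero 1F (suc (suc r)) _ _ q<r r<p = <-asym q<r (All.lookup⁺ h r r<p)
layered-no-312 (fall _ h ∷ ps) zero (suc (suc q)) (suc (suc r)) _ (s≤s q<r) q<ʳ r<p =
  layered-no-312 ps zero (suc q) (suc r) (s≤s z≤n) q<r q<ʳ (All.lookup⁺ h r r<p)

-- A minimum or maximum of a suffix cannot lie strictly between two later entries. The order of
-- positions `q` and `r` is left open, so that both 213 and 231 are covered.
extremal-no-middle : ∀ {n s} {π : Vec ℕ n} → Shaped ExtremalStep s π →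
  ∀ p q r → p Fin.< q → p Fin.< r →
  lookup π q < lookup π p → lookup π p < lookup π r → ⊥
extremal-no-middle (_ ∷ ps) (suc p) (suc q) (suc r) (s≤s p<q) (s≤s p<r) =
  extremal-no-middle ps p q r p<q p<r
extremal-no-middle (rise h ∷ _)  zero (suc q) r _ _ q<p _ = <-asym q<p (All.lookup⁺ h q)
extremal-no-middle (fall h ∷ _) zero q (suc r) _ _ _ p<r = <-asym p<r (All.lookup⁺ h r)

-- Layered permutations: avoiding 231 and 312

layered : Family (2 ∷ 3 ∷ 1 ∷ []) (3 ∷ 1 ∷ 2 ∷ [])
layered = record
  { Step          = LayeredStep
  ; step-ascent   = λ where
      (rise (x<y ∷ _)) → dec-true (_ <? _) x<y
      (fall y<x _)     → dec-false (_ <? _) (<-asym y<x)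
  ; step-map      = λ where
      mono (rise h)     → rise (All.gmap mono h)
      mono (fall y<x h) → fall (mono y<x) (All.gmap (λ g → mono ∘ g ∘ cancel-< mono) h)
  ; step-rank     = step-rank
  ; avoids⇒step   = avoids⇒step
  ; shaped⇒avoids = λ ps → avoids-231 ps , avoids-312 ps
  ; newHead       = newHead
  ; newHead-range = λ where
      true          _                   → s≤s z≤n , s≤s z≤n
      false {_ ∷ _} (_ , (_ , y≤n) ∷ _) → s≤s z≤n , s≤s y≤n
  ; newHead-step  = newHead-step
  }
  where
  avoids-231 : ∀ {n s} {π : Vec ℕ n} → Shaped LayeredStep s π → Avoids π (2 ∷ 3 ∷ 1 ∷ [])
  avoids-231 ps (p ∷ q ∷ r ∷ [] , inc , iso) =
    layered-no-231 ps p q r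
      (inc 0F 1F (s≤s z≤n)) (inc 1F 2F (s≤s (s≤s z≤n)))
      (Equivalence.from (iso 2F 0F) (from-yes (1 <? 2)))
      (Equivalence.from (iso 0F 1F) (from-yes (2 <? 3)))

  avoids-312 : ∀ {n s} {π : Vec ℕ n} → Shaped LayeredStep s π → Avoids π (3 ∷ 1 ∷ 2 ∷ [])
  avoids-312 ps (p ∷ q ∷ r ∷ [] , inc , iso) =
    layered-no-312 ps p q r
      (inc 0F 1F (s≤s z≤n)) (inc 1F 2F (s≤s (s≤s z≤n)))
      (Equivalence.from (iso 1F 2F) (from-yes (1 <? 2)))
      (Equivalence.from (iso 2F 0F) (from-yes (2 <? 3)))

  -- The entries of `w` below `x` are exactly those below `y`, and `y` adds one; so the digit of `x`
  -- is one more than the digit of `y`.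
  rank-fall : y < x → All (λ v → v < x → v < y) w → rank x (y ∷ w) ≡ suc (rank y w)
  rank-fall {w = w} y<x h = trans (rank-∷ {w = w} y<x)
    (cong suc (rank-cong (All.map (λ g → mk⇔ g (λ v<y → <-trans v<y y<x)) h)))

  step-rank : {w w′ : Vec ℕ (suc n)} → LayeredStep b x w → LayeredStep b x′ w′ →
    lehmer w ≡ lehmer w′ → rank x w ≡ rank x′ w′
  step-rank (rise h)     (rise h′)      _  = trans (rank-min h) (sym (rank-min h′))
  step-rank (fall y<x h) (fall y<x′ h′) eq =
    trans (rank-fall y<x h) (trans (cong suc (proj₁ (∷-injective eq))) (sym (rank-fall y<x′ h′)))

  -- After an ascent, a later `v < x` would make `x y v` a 231; after a descent, a later `v`
  -- strictly between `y` and `x` would make it a 312.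
  avoids⇒step : Unique (x ∷ y ∷ w) → Avoids (x ∷ y ∷ w) (2 ∷ 3 ∷ 1 ∷ []) →
    Avoids (x ∷ y ∷ w) (3 ∷ 1 ∷ 2 ∷ []) → LayeredStep (does (x <? y)) x (y ∷ w)
  avoids⇒step {x} {y} {w = w} ((x≢y ∷ x∉w) ∷ y∉w ∷ _) a231 a312 =
    does-elim (λ b → LayeredStep b x (y ∷ w)) (x <? y) ascending
      (λ x≮y → descending (≤∧≢⇒< (≮⇒≥ x≮y) (≢-sym x≢y)))
    where
    ascending : x < y → LayeredStep true x (y ∷ w)
    ascending x<y = rise (x<y ∷ All.lookup⁻ λ k → ≤∧≢⇒< (≮⇒≥ λ v<x → a231
      (contains-first-two k (inj₁ (x<y , from-yes (2 <? 3))) (inj₂ (v<x , from-yes (1 <? 2)))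
        (inj₂ (<-trans v<x x<y , from-yes (1 <? 3))))) (All.lookup⁺ x∉w k))

    descending : y < x → LayeredStep false x (y ∷ w)
    descending y<x = fall y<x (All.lookup⁻ λ k v<x → ≤∧≢⇒< (≮⇒≥ λ y<v → a312
      (contains-first-two k (inj₂ (y<x , from-yes (1 <? 3))) (inj₂ (v<x , from-yes (2 <? 3)))
        (inj₁ (y<v , from-yes (1 <? 2))))) (≢-sym (All.lookup⁺ y∉w k)))

  -- For a descent the new value is inserted just above `y`: `bump (suc y)` fixes `y` and moves all
  -- larger entries above `suc y`, so `y` is the largest later value below the new head.
  newHead : Bool → Vec ℕ (suc n) → ℕ
  newHead true  _       = 1
  newHead false (y ∷ _) = suc y

  newHead-step : ∀ b {π : Vec ℕ (suc n)} → IsPermutation π →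
    LayeredStep b (newHead b π) (map (bump (newHead b π)) π)
  newHead-step true          (_ , r)         = rise (bump-1-> r)
  newHead-step false {y ∷ w} (y∉w ∷ _ , _) rewrite bump-< (n<1+n y) =
    fall (n<1+n y) (All.gmap below y∉w)
    where
    below : ∀ {v} → y ≢ v → bump (suc y) v < suc y → bump (suc y) v < y
    below {v} y≢v lt with v <? suc y
    ... | yes (s≤s v≤y) = ≤∧≢⇒< v≤y (≢-sym y≢v)
    ... | no  v≮1+y     = contradiction (<-trans (n<1+n v) lt) v≮1+y

-- Permutations with extremal entries: avoiding 213 and 231

extremal : Family (2 ∷ 1 ∷ 3 ∷ []) (2 ∷ 3 ∷ 1 ∷ [])
extremal = record
  { Step          = ExtremalStep
  ; step-ascent   = λ where
      (rise (x<y ∷ _)) → dec-true (_ <? _) x<y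
      (fall (y<x ∷ _)) → dec-false (_ <? _) (<-asym y<x)
  ; step-map      = λ where
      mono (rise h) → rise (All.gmap mono h)
      mono (fall h) → fall (All.gmap mono h)
  -- The digit of an extremal head is `0` or the length of the tail, according to the bit.
  ; step-rank     = λ where
      (rise h) (rise h′) _ → trans (rank-min h) (sym (rank-min h′))
      (fall h) (fall h′) _ → trans (rank-max h) (sym (rank-max h′))
  ; avoids⇒step   = avoids⇒step
  ; shaped⇒avoids = λ ps → avoids-213 ps , avoids-231 ps
  ; newHead       = newHead
  ; newHead-range = λ where
      true  _ → s≤s z≤n , s≤s z≤n
      false _ → s≤s z≤n , ≤-refl
  ; newHead-step  = λ where
      true  (_ , r) → rise (bump-1-> r)
      false (_ , r) → fall (All.gmap
        (λ (_ , v≤n) → subst (_< _) (sym (bump-< (s≤s v≤n))) (s≤s v≤n)) r)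
  }
  where
  avoids-213 : ∀ {n s} {π : Vec ℕ n} → Shaped ExtremalStep s π → Avoids π (2 ∷ 1 ∷ 3 ∷ [])
  avoids-213 ps (p ∷ q ∷ r ∷ [] , inc , iso) =
    extremal-no-middle ps p q r
      (inc 0F 1F (s≤s z≤n)) (inc 0F 2F (s≤s z≤n))
      (Equivalence.from (iso 1F 0F) (from-yes (1 <? 2)))
      (Equivalence.from (iso 0F 2F) (from-yes (2 <? 3)))

  avoids-231 : ∀ {n s} {π : Vec ℕ n} → Shaped ExtremalStep s π → Avoids π (2 ∷ 3 ∷ 1 ∷ [])
  avoids-231 ps (p ∷ q ∷ r ∷ [] , inc , iso) =
    -- In 231 the smaller of the two later entries comes last, so `q` and `r` are exchanged.
    extremal-no-middle ps p r q
      (inc 0F 2F (s≤s z≤n)) (inc 0F 1F (s≤s z≤n))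
      (Equivalence.from (iso 2F 0F) (from-yes (1 <? 2)))
      (Equivalence.from (iso 0F 1F) (from-yes (2 <? 3)))

  -- After an ascent, a later `v < x` would make `x y v` a 231; after a descent, a later `v > x`
  -- would make it a 213.
  avoids⇒step : Unique (x ∷ y ∷ w) → Avoids (x ∷ y ∷ w) (2 ∷ 1 ∷ 3 ∷ []) →
    Avoids (x ∷ y ∷ w) (2 ∷ 3 ∷ 1 ∷ []) → ExtremalStep (does (x <? y)) x (y ∷ w)
  avoids⇒step {x} {y} {w = w} ((x≢y ∷ x∉w) ∷ _) a213 a231 =
    does-elim (λ b → ExtremalStep b x (y ∷ w)) (x <? y) ascending
      (λ x≮y → descending (≤∧≢⇒< (≮⇒≥ x≮y) (≢-sym x≢y)))
    where
    ascending : x < y → ExtremalStep true x (y ∷ w)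
    ascending x<y = rise (x<y ∷ All.lookup⁻ λ k → ≤∧≢⇒< (≮⇒≥ λ v<x → a231
      (contains-first-two k (inj₁ (x<y , from-yes (2 <? 3))) (inj₂ (v<x , from-yes (1 <? 2)))
        (inj₂ (<-trans v<x x<y , from-yes (1 <? 3))))) (All.lookup⁺ x∉w k))

    descending : y < x → ExtremalStep false x (y ∷ w)
    descending y<x = fall (y<x ∷ All.lookup⁻ λ k → ≤∧≢⇒< (≮⇒≥ λ x<v → a213
      (contains-first-two k (inj₂ (y<x , from-yes (1 <? 2))) (inj₁ (x<v , from-yes (2 <? 3)))
        (inj₁ (<-trans y<x x<v , from-yes (1 <? 3))))) (≢-sym (All.lookup⁺ x∉w k)))

  -- The new head is the new minimum or the new maximum; the extended permutation has length
  -- `suc (suc n)`.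
  newHead : Bool → Vec ℕ (suc n) → ℕ
  newHead     true  _ = 1
  newHead {n} false _ = suc (suc n)

-- Statistics

Statistics : Set
Statistics = ℕ × ℕ × ℕ × ℕ

statistics : Vec ℕ n → Statistics
statistics π = asc π , des π , MNA π , MND π

ascentStatistics : ∀ {m} → Subset m → Statistics
ascentStatistics s = ∣ s ∣ , ∣ ∁ s ∣ , maxNonAdjacent s , maxNonAdjacent (∁ s)

-- Neighbouring entries are distinct, so a position that is not an ascent is a descent.
positions-> : {π : Vec ℕ n} → Unique π → positions _>?_ π ≡ ∁ (positions _<?_ π)
positions-> []                                    = refl
positions-> (_ ∷ [])                              = refl
positions-> {π = x ∷ y ∷ w} ((x≢y ∷ _) ∷ yw!) = cong₂ _∷_ head (positions-> yw!)
  where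
  head : does (x >? y) ≡ not (does (x <? y))
  head with <-cmp x y
  ... | tri< x<y _ y≮x = trans (dec-false (x >? y) y≮x) (cong not (sym (dec-true (x <? y) x<y)))
  ... | tri≈ _ x≡y _   = contradiction x≡y x≢y
  ... | tri> x≮y _ y<x = trans (dec-true (x >? y) y<x) (cong not (sym (dec-false (x <? y) x≮y)))

statistics-ascents : {π : Vec ℕ n} → Unique π → statistics π ≡ ascentStatistics (positions _<?_ π)
statistics-ascents {π = π} π! =
  -- `asc` and `MNA` are functions of the ascent set by definition; only `des` and `MND` are
  -- rewritten.
  cong (λ s → asc π , ∣ s ∣ , MNA π , maxNonAdjacent s) (positions-> π!)

-- The right-hand side is independent of the patterns, so any two families can be compared through
-- it.
statistics-avoiders : ∀ {τ ρ} → Family τ ρ → ∀ n →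
  List.map statistics (avoiders n τ ρ) ↭ List.map ascentStatistics (subsets (pred n))
statistics-avoiders F n = ↭-trans (map⁺ statistics (avoiders-↭ F n))
  (↭-reflexive (trans (sym (List.map-∘ (subsets (pred n)))) (List.map-cong
    (λ s → trans (statistics-ascents (proj₁ (perm-isPermutation F n s)))
                 (cong ascentStatistics (positions-perm F n s)))
    (subsets (pred n)))))

frequency-cong : {L M : List (Vec ℕ n)} → List.map statistics L ↭ List.map statistics M →
  ∀ a d p q → frequency L a d p q ≡ frequency M a d p q
frequency-cong {L = L} {M} eq a d p q = begin
  frequency L a d p q                                ≡⟨ length-filter-map has? statistics L ⟨
  length (filter has? (List.map statistics L))       ≡⟨ ↭-length (filter-↭ has? eq) ⟩
  length (filter has? (List.map statistics M))       ≡⟨ length-filter-map has? statistics M ⟩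
  frequency M a d p q                                ∎
  where
  open ≡-Reasoning
  has? = λ ((a′ , d′ , p′ , q′) : Statistics) →
    (a′ ≟ a) ×-dec (d′ ≟ d) ×-dec (p′ ≟ p) ×-dec (q′ ≟ q)

-- Generating functions

module _ {c ℓ} (R : CommutativeSemiring c ℓ) (t₁ t₂ t₃ t₄ : CommutativeSemiring.Carrier R) where
  open CommutativeSemiring R
    using (Carrier; _≈_; _+_; _*_; 0#; rawSemiring; +-isCommutativeMonoid; isEquivalence)
    renaming (setoid to R-setoid; trans to ≈-trans; sym to ≈-sym; reflexive to ≈-reflexive)
  open import Algebra.Definitions.RawSemiring rawSemiring using (_^_)

  monomial : Statistics → Carrier
  monomial (a , d , p , q) = t₁ ^ a * t₂ ^ d * t₃ ^ p * t₄ ^ q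

  generatingFunction-monomial : (L : List (Vec ℕ n)) →
    generatingFunction R t₁ t₂ t₃ t₄ L ≡
    List.foldr _+_ 0# (List.map monomial (List.map statistics L))
  generatingFunction-monomial L = cong (List.foldr _+_ 0#) (List.map-∘ L)

  -- The value is a sum over the list of statistics, and a sum in a commutative monoid is invariant
  -- under rearrangement.
  generatingFunction-cong : {L M : List (Vec ℕ n)} → List.map statistics L ↭ List.map statistics M →
    generatingFunction R t₁ t₂ t₃ t₄ L ≈ generatingFunction R t₁ t₂ t₃ t₄ M
  generatingFunction-cong {L = L} {M} eq = ≈-trans
    (≈-reflexive (generatingFunction-monomial L))
    (≈-trans (↭ₛ.foldr-commMonoid R-setoid +-isCommutativeMonoid
               (↭⇒↭ₛ′ isEquivalence (map⁺ monomial eq)))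
             (≈-reflexive (sym (generatingFunction-monomial M))))

theorem16 : ∀ {c ℓ} (n : ℕ) →
    let A = avoiders n (2 ∷ 3 ∷ 1 ∷ []) (3 ∷ 1 ∷ 2 ∷ [])
        B = avoiders n (2 ∷ 1 ∷ 3 ∷ []) (2 ∷ 3 ∷ 1 ∷ [])
    in (∀ a d p q → frequency A a d p q ≡ frequency B a d p q)
       × (∀ (R : CommutativeSemiring c ℓ) (t₁ t₂ t₃ t₄ : CommutativeSemiring.Carrier R) →
            CommutativeSemiring._≈_ R (generatingFunction R t₁ t₂ t₃ t₄ A) (generatingFunction R t₁ t₂ t₃ t₄ B))
theorem16 n =
  frequency-cong {L = A} {B} eq ,
  λ R t₁ t₂ t₃ t₄ → generatingFunction-cong R t₁ t₂ t₃ t₄ {L = A} {B} eq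
  where
  A = avoiders n (2 ∷ 3 ∷ 1 ∷ []) (3 ∷ 1 ∷ 2 ∷ [])
  B = avoiders n (2 ∷ 1 ∷ 3 ∷ []) (2 ∷ 3 ∷ 1 ∷ [])
  eq : List.map statistics A ↭ List.map statistics B
  eq = ↭-trans (statistics-avoiders layered n) (↭-sym (statistics-avoiders extremal n))
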